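{- For every nonnegative integer $n$, $$\sum_{k=0}^{\infty}(-1)^k(4k+1)\,\frac{(-n)_k\,(-3n-1)_k\,(\tfrac12)_k}{k!\,(n+\tfrac32)_k\,(3n+\tfrac52)_k}=\left(\frac{3^3}{2^8}\right)^n\frac{(\tfrac76)_n(\tfrac56)_n(\tfrac32)_n^2}{(\tfrac58)_n(\tfrac78)_n(\tfrac98)_n(\tfrac{11}{8})_n}.$$ (The sum is finite, since $(-n)_k=0$ for $k>n$.)
   Context: $(a)_j=\Gamma(a+j)/\Gamma(a)=a(a+1)\cdots(a+j-1)$ denotes the rising factorial (Pochhammer symbol), with $(a)_0=1$. -}

module Defs where

open import Algebra.Definitions.RawSemiring using () renaming (_^_ to pow; sum to sumOver)
open import Data.Fin.Base using (toℕ)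
open import Data.Integer.Base using (+_)
open import Data.Nat.Base as ℕ using (ℕ; zero; suc; _!)
open import Data.Nat.Properties using (_!≢0)
open import Data.Product.Base using (∃-syntax; _×_)
open import Data.Rational.Base
open import Data.Rational.Properties
open import Relation.Binary.PropositionalEquality.Core using (_≡_)

ι : ℕ → ℚ
ι n = + n / 1

infixr 8 _^_

_^_ : ℚ → ℕ → ℚ
_^_ = pow +-*-rawSemiring

-- The rising factorial (a)ⱼ = a (a + 1) ⋯ (a + j − 1).
infixl 9 ⦅_⦆_

⦅_⦆_ : ℚ → ℕ → ℚ
⦅ a ⦆ zero  = 1ℚ
⦅ a ⦆ suc j = ⦅ a ⦆ j * (a + ι j)

∑[k<_] : ℕ → (ℕ → ℚ) → ℚ
∑[k< m ] f = sumOver +-*-rawSemiring {m} (λ i → f (toℕ i))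

-- f has only finitely many nonzero terms, and ∑_{k=0}^∞ f k = s.  The value s
-- does not depend on the cut-off m beyond which f vanishes.
HasSum : (ℕ → ℚ) → ℚ → Set
HasSum f s = ∃[ m ] ((∀ k → m ℕ.≤ k → f k ≡ 0ℚ) × ∑[k< m ] f ≡ s)

-- Division in ℚ requires a proof that the divisor is nonzero; every divisor
-- below is a product of positive factors.

0<+ : ∀ {p q} → 0ℚ ≤ p → 0ℚ < q → 0ℚ < p + q
0<+ = +-mono-≤-<

0<* : ∀ {p q} → 0ℚ < p → 0ℚ < q → 0ℚ < p * q
0<* {p} {q} 0<p 0<q =
  positive⁻¹ (p * q) {{pos*pos⇒pos p {{positive 0<p}} q {{positive 0<q}}}}

0≤ι : ∀ n → 0ℚ ≤ ι n
0≤ι n = nonNegative⁻¹ (ι n) {{normalize-nonNeg n 1}}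

0<ι : ∀ n → .{{ℕ.NonZero n}} → 0ℚ < ι n
0<ι n = positive⁻¹ (ι n) {{normalize-pos n 1}}

0≤ι*ι : ∀ m n → 0ℚ ≤ ι m * ι n
0≤ι*ι m n = nonNegative⁻¹ (ι m * ι n)
  {{nonNeg*nonNeg⇒nonNeg (ι m) {{normalize-nonNeg m 1}} (ι n) {{normalize-nonNeg n 1}}}}

0<⦅⦆ : ∀ {a} → 0ℚ < a → ∀ j → 0ℚ < ⦅ a ⦆ j
0<⦅⦆ 0<a zero    = positive⁻¹ 1ℚ
0<⦅⦆ {a} 0<a (suc j) = 0<* (0<⦅⦆ 0<a j) (+-mono-<-≤ 0<a (0≤ι j))

term-denominator≢0 : ∀ n k →
  NonZero (ι (k !) * ⦅ ι n + + 3 / 2 ⦆ k * ⦅ ι 3 * ι n + + 5 / 2 ⦆ k)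
term-denominator≢0 n k = >-nonZero
  (0<* (0<* (0<ι (k !) {{k !≢0}})
            (0<⦅⦆ {ι n + + 3 / 2} (0<+ (0≤ι n) (positive⁻¹ (+ 3 / 2))) k))
       (0<⦅⦆ {ι 3 * ι n + + 5 / 2} (0<+ (0≤ι*ι 3 n) (positive⁻¹ (+ 5 / 2))) k))

value-denominator≢0 : ∀ n →
  NonZero (⦅ + 5 / 8 ⦆ n * ⦅ + 7 / 8 ⦆ n * ⦅ + 9 / 8 ⦆ n * ⦅ + 11 / 8 ⦆ n)
value-denominator≢0 n = >-nonZero
  (0<* (0<* (0<* (0<⦅⦆ (positive⁻¹ (+ 5 / 8)) n) (0<⦅⦆ (positive⁻¹ (+ 7 / 8)) n))
            (0<⦅⦆ (positive⁻¹ (+ 9 / 8)) n))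
       (0<⦅⦆ (positive⁻¹ (+ 11 / 8)) n))

{-# OPTIONS --safe #-}

-- The series is a very-well-poised ₄F₃(−1).  For c + y = 1 + a,
--   ∑ₖ (−1)ᵏ (a + 2k) (−n)ₖ (c)ₖ (a)ₖ / (k! (n + 1 + a)ₖ (y)ₖ) = (a)ₙ₊₁ / (y)ₙ,
-- by induction on n with a, c, y fixed: writing t n k for the summand and
-- e = n + 1 + a, the Wilf–Zeilberger certificate
--   γ n k = (−1)ᵏ (−n)ₖ (c)ₖ₊₁ (a)ₖ₊₁ / (k! (e)ₖ₊₁ (y)ₖ)
-- satisfies (y + n) t (n+1) k − e t n k = e (γ n (k−1) − γ n k).  With a = 1/2,
-- c = −3n − 1, y = 3n + 5/2 twice this sum is (3/2)ₙ / (3n + 5/2)ₙ, and Gauss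
-- multiplication of (5/2)₃ₙ and (5/2)₄ₙ turns that into the stated product.
module Submission where

open import Defs
open import Algebra.Properties.CommutativeSemiring.Exp using (^-distrib-*)
import Algebra.Properties.Semiring.Sum as Sum
open import Algebra.Bundles using (CommutativeRing)
open import Data.Fin.Base using (toℕ)
open import Data.Integer.Base as ℤ using (+_)
import Data.Integer.Properties as ℤ
open import Data.Nat.Base as ℕ using (ℕ; zero; suc; _!)
import Data.Nat.Properties as ℕ
open import Data.Product.Base using (_,_)
open import Data.Rational.Base
open import Data.Rational.Properties
open import Data.Rational.Solver using (module +-*-Solver)
import Data.Rational.Unnormalised.Base as ℚᵘ
import Data.Rational.Unnormalised.Properties as ℚᵘ
open import Relation.Binary.PropositionalEquality
open +-*-Solver using (solve; con; _:=_; _:+_; _:*_; _:-_; :-_)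
open ≡-Reasoning

open CommutativeRing +-*-commutativeRing using (semiring; commutativeSemiring)

-- Natural numbers inside the rationals.

toℚᵘ-ι : ∀ n → toℚᵘ (ι n) ℚᵘ.≃ ℚᵘ.mkℚᵘ (+ n) 0
toℚᵘ-ι n = toℚᵘ-fromℚᵘ (ℚᵘ.mkℚᵘ (+ n) 0)

-- `ι` normalises its fraction and is stuck at a variable, so the identity is checked on
-- unnormalised representatives, where it is one about integers.
ι-+ : ∀ m n → ι (m ℕ.+ n) ≡ ι m + ι n
ι-+ m n = toℚᵘ-injective (ℚᵘ.≃-trans (toℚᵘ-ι (m ℕ.+ n))
  (ℚᵘ.≃-trans (ℚᵘ.*≡* (cong (ℤ._* + 1) (sym
      (cong₂ ℤ._+_ (ℤ.*-identityʳ (+ m)) (ℤ.*-identityʳ (+ n))))))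
  (ℚᵘ.≃-sym (ℚᵘ.≃-trans (toℚᵘ-homo-+ (ι m) (ι n))
    (ℚᵘ.+-cong (toℚᵘ-ι m) (toℚᵘ-ι n))))))

ι-* : ∀ m n → ι (m ℕ.* n) ≡ ι m * ι n
ι-* m n = toℚᵘ-injective (ℚᵘ.≃-trans (toℚᵘ-ι (m ℕ.* n))
  (ℚᵘ.≃-trans (ℚᵘ.*≡* (cong (ℤ._* + 1) (ℤ.pos-* m n)))
  (ℚᵘ.≃-sym (ℚᵘ.≃-trans (toℚᵘ-homo-* (ι m) (ι n))
    (ℚᵘ.*-cong (toℚᵘ-ι m) (toℚᵘ-ι n))))))

ι-suc : ∀ n → ι (suc n) ≡ ι n + 1ℚ
ι-suc n = trans (ι-+ 1 n) (+-comm 1ℚ (ι n))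

-- Rising factorials and their multiplication formulas.

⦅⦆-shift : ∀ a j → ⦅ a ⦆ (suc j) ≡ a * ⦅ a + 1ℚ ⦆ j
⦅⦆-shift a zero = solve 1 (λ a → con 1ℚ :* (a :+ con 0ℚ) := a :* con 1ℚ) refl a
⦅⦆-shift a (suc j) = begin
  ⦅ a ⦆ (suc j) * (a + ι (suc j))      ≡⟨ cong₂ (λ p k → p * (a + k)) (⦅⦆-shift a j) (ι-suc j) ⟩
  a * ⦅ a + 1ℚ ⦆ j * (a + (ι j + 1ℚ))
    ≡⟨ solve 3 (λ a p k → a :* p :* (a :+ (k :+ con 1ℚ)) := a :* (p :* (a :+ con 1ℚ :+ k)))
         refl a (⦅ a + 1ℚ ⦆ j) (ι j) ⟩
  a * (⦅ a + 1ℚ ⦆ j * (a + 1ℚ + ι j))  ∎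

⦅⦆-+ : ∀ a m n → ⦅ a ⦆ (n ℕ.+ m) ≡ ⦅ a ⦆ m * ⦅ a + ι m ⦆ n
⦅⦆-+ a m zero    = sym (*-identityʳ (⦅ a ⦆ m))
⦅⦆-+ a m (suc n) = begin
  ⦅ a ⦆ (n ℕ.+ m) * (a + ι (n ℕ.+ m))
    ≡⟨ cong₂ (λ p k → p * (a + k)) (⦅⦆-+ a m n) (ι-+ n m) ⟩
  ⦅ a ⦆ m * ⦅ a + ι m ⦆ n * (a + (ι n + ι m))
    ≡⟨ solve 5 (λ p q a m n → p :* q :* (a :+ (n :+ m)) := p :* (q :* (a :+ m :+ n)))
         refl (⦅ a ⦆ m) (⦅ a + ι m ⦆ n) a (ι m) (ι n) ⟩
  ⦅ a ⦆ m * (⦅ a + ι m ⦆ n * (a + ι m + ι n)) ∎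

-- The factor of index n is `- ι n + ι n`. Induction along `<′` follows the recursion: every later
-- factor multiplies a product that is already zero.
⦅-ι⦆-vanishes : ∀ {n k} → n ℕ.<′ k → ⦅ - ι n ⦆ k ≡ 0ℚ
⦅-ι⦆-vanishes {n} ℕ.≤′-refl =
  trans (cong (⦅ - ι n ⦆ n *_) (+-inverseˡ (ι n))) (*-zeroʳ (⦅ - ι n ⦆ n))
⦅-ι⦆-vanishes {n} (ℕ.≤′-step {k} n<k) =
  trans (cong (_* (- ι n + ι k)) (⦅-ι⦆-vanishes n<k)) (*-zeroˡ (- ι n + ι k))

-- The three factors 3b + 3n + i added in one step are 3 (b + n + i/3). The index is `n ℕ.* 3`
-- because at `suc n` it computes to three successors, which unfolds these factors.
⦅⦆-triplication : ∀ b n →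
  ⦅ ι 3 * b ⦆ (n ℕ.* 3) ≡ ι 27 ^ n * (⦅ b ⦆ n * ⦅ b + + 1 / 3 ⦆ n * ⦅ b + + 2 / 3 ⦆ n)
⦅⦆-triplication b zero = refl
⦅⦆-triplication b (suc n) =
  step b (⦅ b ⦆ n) (⦅ b + + 1 / 3 ⦆ n) (⦅ b + + 2 / 3 ⦆ n) (ι 27 ^ n) (ι n)
    (⦅⦆-triplication b n) (ι-* n 3) (ι-+ 1 (n ℕ.* 3)) (ι-+ 2 (n ℕ.* 3))
  where
  -- Products, powers and indices become variables tied by equations; matching on `refl` leaves a
  -- polynomial identity.
  step : ∀ b p₀ p₁ p₂ u n {p m m₁ m₂} → p ≡ u * (p₀ * p₁ * p₂) →
    m ≡ n * ι 3 → m₁ ≡ ι 1 + m → m₂ ≡ ι 2 + m →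
    p * (ι 3 * b + m) * (ι 3 * b + m₁) * (ι 3 * b + m₂)
    ≡ ι 27 * u * (p₀ * (b + n) * (p₁ * (b + + 1 / 3 + n)) * (p₂ * (b + + 2 / 3 + n)))
  step b p₀ p₁ p₂ u n refl refl refl refl =
    solve 6 (λ b p₀ p₁ p₂ u n → let 3b = con (ι 3) :* b ; m = n :* con (ι 3) in
      u :* (p₀ :* p₁ :* p₂) :* (3b :+ m) :* (3b :+ (con (ι 1) :+ m)) :* (3b :+ (con (ι 2) :+ m))
      := con (ι 27) :* u :* (p₀ :* (b :+ n) :* (p₁ :* (b :+ con (+ 1 / 3) :+ n))
                                            :* (p₂ :* (b :+ con (+ 2 / 3) :+ n))))
      refl b p₀ p₁ p₂ u n

-- The constant 4⁴ = 256 stands on the left as its inverse, ready to merge with 27ⁿ into (27/256)ⁿ.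
⦅⦆-quadruplication : ∀ b n →
  (+ 1 / 256) ^ n * ⦅ ι 4 * b ⦆ (n ℕ.* 4)
  ≡ ⦅ b ⦆ n * ⦅ b + + 1 / 4 ⦆ n * ⦅ b + + 2 / 4 ⦆ n * ⦅ b + + 3 / 4 ⦆ n
⦅⦆-quadruplication b zero = refl
⦅⦆-quadruplication b (suc n) = trans
  -- 256 cancels against the four new factors, so the left side at n reappears and the induction
  -- hypothesis rewrites it.
  (step b ((+ 1 / 256) ^ n) (ι n) (⦅ ι 4 * b ⦆ (n ℕ.* 4))
    (ι-* n 4) (ι-+ 1 (n ℕ.* 4)) (ι-+ 2 (n ℕ.* 4)) (ι-+ 3 (n ℕ.* 4)))
  (trans (cong (_* ((b + ι n) * (b + + 1 / 4 + ι n) * (b + + 2 / 4 + ι n) * (b + + 3 / 4 + ι n)))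
            (⦅⦆-quadruplication b n))
    (solve 8 (λ p₀ p₁ p₂ p₃ x₀ x₁ x₂ x₃ →
        p₀ :* p₁ :* p₂ :* p₃ :* (x₀ :* x₁ :* x₂ :* x₃)
        := p₀ :* x₀ :* (p₁ :* x₁) :* (p₂ :* x₂) :* (p₃ :* x₃)) refl
      (⦅ b ⦆ n) (⦅ b + + 1 / 4 ⦆ n) (⦅ b + + 2 / 4 ⦆ n) (⦅ b + + 3 / 4 ⦆ n)
      (b + ι n) (b + + 1 / 4 + ι n) (b + + 2 / 4 + ι n) (b + + 3 / 4 + ι n)))
  where
  step : ∀ b u n p {m m₁ m₂ m₃} →
    m ≡ n * ι 4 → m₁ ≡ ι 1 + m → m₂ ≡ ι 2 + m → m₃ ≡ ι 3 + m →
    (+ 1 / 256) * u * (p * (ι 4 * b + m) * (ι 4 * b + m₁) * (ι 4 * b + m₂) * (ι 4 * b + m₃))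
    ≡ u * p * ((b + n) * (b + + 1 / 4 + n) * (b + + 2 / 4 + n) * (b + + 3 / 4 + n))
  step b u n p refl refl refl refl =
    solve 4 (λ b u n p → let 4b = con (ι 4) :* b ; m = n :* con (ι 4) in
      con (+ 1 / 256) :* u :* (p :* (4b :+ m) :* (4b :+ (con (ι 1) :+ m))
                                 :* (4b :+ (con (ι 2) :+ m)) :* (4b :+ (con (ι 3) :+ m)))
      := u :* p :* ((b :+ n) :* (b :+ con (+ 1 / 4) :+ n)
                      :* (b :+ con (+ 2 / 4) :+ n) :* (b :+ con (+ 3 / 4) :+ n)))
      refl b u n p

-- Tools for quotients and partial sums.

*÷-cross : ∀ s p q p′ q′ r .{{_ : NonZero q}} .{{_ : NonZero q′}} →
  s * p * q′ ≡ p′ * r * q → s * (p ÷ q) ≡ (p′ ÷ q′) * r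
*÷-cross s p q p′ q′ r eq = begin
  s * (p * 1/ q)               ≡⟨ solve 3 (λ s p i → s :* (p :* i) := s :* p :* i :* con 1ℚ)
                                    refl s p (1/ q) ⟩
  s * p * 1/ q * 1ℚ            ≡⟨ cong (s * p * 1/ q *_) (*-inverseʳ q′) ⟨
  s * p * 1/ q * (q′ * 1/ q′)  ≡⟨ solve 5 (λ s p i q j → s :* p :* i :* (q :* j)
                                                      := s :* p :* q :* (i :* j))
                                    refl s p (1/ q) q′ (1/ q′) ⟩
  s * p * q′ * (1/ q * 1/ q′)  ≡⟨ cong (_* (1/ q * 1/ q′)) eq ⟩
  p′ * r * q * (1/ q * 1/ q′)  ≡⟨ solve 5 (λ p r q i j → p :* r :* q :* (i :* j)
                                                      := p :* j :* r :* (q :* i))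
                                    refl p′ r q (1/ q) (1/ q′) ⟩
  p′ * 1/ q′ * r * (q * 1/ q)  ≡⟨ cong (p′ * 1/ q′ * r *_) (*-inverseʳ q) ⟩
  p′ * 1/ q′ * r * 1ℚ          ≡⟨ *-identityʳ (p′ * 1/ q′ * r) ⟩
  (p′ ÷ q′) * r                ∎

-- The library sum unfolds at its first summand; telescoping appends the last.
∑-last : ∀ m f → ∑[k< suc m ] f ≡ ∑[k< m ] f + f m
∑-last zero    f = +-comm (f 0) 0ℚ
∑-last (suc m) f = trans (cong (λ s → f 0 + s) (∑-last m (λ k → f (suc k))))
  (sym (+-assoc (f 0) (∑[k< m ] (λ k → f (suc k))) (f (suc m))))

-- The terminating very-well-poised sum by the Wilf-Zeilberger method.

module WellPoised (a c y : ℚ) (0<a : 0ℚ < a) (0<y : 0ℚ < y) (c+y≡1+a : c + y ≡ 1ℚ + a) where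

  -- The lower parameter 1 + a - (-n) paired with -n, as y is with c and the 1 of k! with a. This
  -- bracketing computes to `ι n + + 3 / 2` at a = 1/2.
  e : ℕ → ℚ
  e n = ι n + (1ℚ + a)

  -- The indices are separate because in `certificate` and `common` the middle one runs one ahead of
  -- the other two.
  denominator : ℕ → ℕ → ℕ → ℕ → ℚ
  denominator n i j k = ι (i !) * ⦅ e n ⦆ j * ⦅ y ⦆ k

  denominator≢0 : ∀ n i j k → NonZero (denominator n i j k)
  denominator≢0 n i j k = >-nonZero
    (0<* (0<* (0<ι (i !) {{i ℕ.!≢0}})
              (0<⦅⦆ (0<+ (0≤ι n) (0<+ (<⇒≤ (positive⁻¹ 1ℚ)) 0<a)) j))
         (0<⦅⦆ 0<y k))

  -- The very-well-poised factor: a (1 + a/2)ₖ = (a + 2k) (a/2)ₖ.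
  weight : ℕ → ℚ
  weight k = a + (ι k + ι k)

  upper : ℕ → ℕ → ℚ
  upper n k = ⦅ - ι n ⦆ k * ⦅ c ⦆ k * ⦅ a ⦆ k

  term : ℕ → ℕ → ℚ
  term n k = (- 1ℚ) ^ k * weight k
    * (upper n k ÷ denominator n k k k) {{denominator≢0 n k k k}}

  numerator : ℕ → ℕ → ℚ
  numerator n k = (- 1ℚ) ^ k * ⦅ - ι n ⦆ k * ⦅ c ⦆ (suc k) * ⦅ a ⦆ (suc k)

  certificate : ℕ → ℕ → ℚ
  certificate n k = (numerator n k ÷ denominator n k (suc k) k) {{denominator≢0 n k (suc k) k}}

  -- All four quantities in telescope are polynomial multiples of common n k.
  common : ℕ → ℕ → ℚ
  common n k = (numerator n k ÷ denominator n (suc k) (suc (suc k)) (suc k))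
    {{denominator≢0 n (suc k) (suc (suc k)) (suc k)}}

  -- The extra sign and the last factor -n + k of (-n)ₖ₊₁ combine to n - k; the factor e + k + 1
  -- compensates the longer rising factorial of e in `common`.
  term-common : ∀ n k → term n (suc k) ≡
    common n k * (weight (suc k) * (ι n - ι k) * (e n + ι (suc k)))
  term-common n k = *÷-cross
    ((- 1ℚ) ^ suc k * weight (suc k)) (upper n (suc k)) (denominator n (suc k) (suc k) (suc k))
    (numerator n k) (denominator n (suc k) (suc (suc k)) (suc k))
    (weight (suc k) * (ι n - ι k) * (e n + ι (suc k)))
    {{denominator≢0 n (suc k) (suc k) (suc k)}}
    {{denominator≢0 n (suc k) (suc (suc k)) (suc k)}}
    (solve 11 (λ σ w A n k C B F E Y x →
       :- con 1ℚ :* σ :* w :* (A :* (:- n :+ k) :* C :* B) :* (F :* (E :* x) :* Y)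
       := σ :* A :* C :* B :* (w :* (n :- k) :* x) :* (F :* E :* Y)) refl
      ((- 1ℚ) ^ k) (weight (suc k)) (⦅ - ι n ⦆ k) (ι n) (ι k)
      (⦅ c ⦆ (suc k)) (⦅ a ⦆ (suc k)) (ι (suc k !)) (⦅ e n ⦆ (suc k)) (⦅ y ⦆ (suc k))
      (e n + ι (suc k)))

  -- Lowering n + 1 to n splits off first factors: (-n-1)ₖ₊₁ = (-n-1) (-n)ₖ, and the rising
  -- factorial of `e n` is `e n` times the one of `e (suc n)` with one factor fewer.
  term-suc-common : ∀ n k → term (suc n) (suc k) ≡
    common n k * (weight (suc k) * ι (suc n) * e n)
  term-suc-common n k = *÷-cross
    ((- 1ℚ) ^ suc k * weight (suc k)) (upper (suc n) (suc k))
    (denominator (suc n) (suc k) (suc k) (suc k))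
    (numerator n k) (denominator n (suc k) (suc (suc k)) (suc k))
    (weight (suc k) * ι (suc n) * e n)
    {{denominator≢0 (suc n) (suc k) (suc k) (suc k)}}
    {{denominator≢0 n (suc k) (suc (suc k)) (suc k)}}
    (step ((- 1ℚ) ^ k) (weight (suc k)) (⦅ - ι n ⦆ k) (ι (suc n))
      (⦅ c ⦆ (suc k)) (⦅ a ⦆ (suc k)) (ι (suc k !)) (⦅ e (suc n) ⦆ (suc k)) (⦅ y ⦆ (suc k))
      (e n) shift₁ shift₂)
    where
    shift₁ : ⦅ - ι (suc n) ⦆ (suc k) ≡ - ι (suc n) * ⦅ - ι n ⦆ k
    shift₁ = trans (⦅⦆-shift (- ι (suc n)) k) (cong (λ x → - ι (suc n) * ⦅ x ⦆ k)
      (trans (cong (λ x → - x + 1ℚ) (ι-suc n))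
        (solve 1 (λ n → :- (n :+ con 1ℚ) :+ con 1ℚ := :- n) refl (ι n))))

    shift₂ : ⦅ e n ⦆ (suc (suc k)) ≡ e n * ⦅ e (suc n) ⦆ (suc k)
    shift₂ = trans (⦅⦆-shift (e n) (suc k)) (cong (λ x → e n * ⦅ x ⦆ (suc k))
      (trans (solve 2 (λ n x → n :+ x :+ con 1ℚ := n :+ con 1ℚ :+ x) refl (ι n) (1ℚ + a))
        (cong (_+ (1ℚ + a)) (sym (ι-suc n)))))

    step : ∀ σ w A n C B F E Y x {A′ E′} → A′ ≡ - n * A → E′ ≡ x * E →
      - 1ℚ * σ * w * (A′ * C * B) * (F * E′ * Y) ≡ σ * A * C * B * (w * n * x) * (F * E * Y)
    step σ w A n C B F E Y x refl refl =
      solve 10 (λ σ w A n C B F E Y x →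
        :- con 1ℚ :* σ :* w :* (:- n :* A :* C :* B) :* (F :* (x :* E) :* Y)
        := σ :* A :* C :* B :* (w :* n :* x) :* (F :* E :* Y)) refl σ w A n C B F E Y x

  certificate-common : ∀ n k → certificate n k ≡
    common n k * (ι (suc k) * (y + ι k) * (e n + ι (suc k)))
  certificate-common n k = trans (sym (*-identityˡ (certificate n k)))
    (*÷-cross 1ℚ (numerator n k) (denominator n k (suc k) k)
      (numerator n k) (denominator n (suc k) (suc (suc k)) (suc k))
      (ι (suc k) * (y + ι k) * (e n + ι (suc k)))
      {{denominator≢0 n k (suc k) k}} {{denominator≢0 n (suc k) (suc (suc k)) (suc k)}}
      (step (numerator n k) (ι (suc k)) (ι (k !)) (⦅ e n ⦆ (suc k)) (e n + ι (suc k))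
        (⦅ y ⦆ k) (y + ι k) (ι-* (suc k) (k !))))
    where
    step : ∀ p k F E x Y z {F′} → F′ ≡ k * F →
      1ℚ * p * (F′ * (E * x) * (Y * z)) ≡ p * (k * z * x) * (F * E * Y)
    step p k F E x Y z refl = solve 7 (λ p k F E x Y z →
      con 1ℚ :* p :* (k :* F :* (E :* x) :* (Y :* z)) := p :* (k :* z :* x) :* (F :* E :* Y))
      refl p k F E x Y z

  certificate-suc-common : ∀ n k → certificate n (suc k) ≡
    common n k * ((ι n - ι k) * (c + ι (suc k)) * (a + ι (suc k)))
  certificate-suc-common n k = trans (sym (*-identityˡ (certificate n (suc k))))
    (*÷-cross 1ℚ (numerator n (suc k)) (denominator n (suc k) (suc (suc k)) (suc k))
      (numerator n k) (denominator n (suc k) (suc (suc k)) (suc k))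
      ((ι n - ι k) * (c + ι (suc k)) * (a + ι (suc k)))
      {{denominator≢0 n (suc k) (suc (suc k)) (suc k)}}
      {{denominator≢0 n (suc k) (suc (suc k)) (suc k)}}
      (solve 9 (λ σ A n k C c B b q →
         con 1ℚ :* (:- con 1ℚ :* σ :* (A :* (:- n :+ k)) :* (C :* c) :* (B :* b)) :* q
         := σ :* A :* C :* B :* ((n :- k) :* c :* b) :* q) refl
        ((- 1ℚ) ^ k) (⦅ - ι n ⦆ k) (ι n) (ι k) (⦅ c ⦆ (suc k)) (c + ι (suc k))
        (⦅ a ⦆ (suc k)) (a + ι (suc k)) (denominator n (suc k) (suc (suc k)) (suc k))))

  -- The certificate relation at index k + 1, which avoids k - 1 and leaves index 0 to
  -- `telescope-zero`; subtracted quantities are moved to the opposite side.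
  telescope : ∀ n k →
    term (suc n) (suc k) * (y + ι n) + e n * certificate n (suc k)
    ≡ term n (suc k) * e n + e n * certificate n k
  telescope n k = begin
    term (suc n) (suc k) * (y + ι n) + e n * certificate n (suc k)
      ≡⟨ cong₂ (λ t g → t * (y + ι n) + e n * g) (term-suc-common n k) (certificate-suc-common n k) ⟩
    -- With `common n k` factored out and c replaced by 1 + a - y, a polynomial identity in n, k, a,
    -- y remains.
    _ ≡⟨ identity (common n k) (ι n) (ι k) a y (ι-suc n) (ι-suc k) c≡1+a-y ⟩
    _ ≡⟨ cong₂ (λ t g → t * e n + e n * g) (term-common n k) (certificate-common n k) ⟨
    term n (suc k) * e n + e n * certificate n k ∎
    where
    c≡1+a-y : c ≡ 1ℚ + a - y
    c≡1+a-y = trans (solve 2 (λ c y → c := c :+ y :- y) refl c y) (cong (_- y) c+y≡1+a)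

    identity : ∀ β n k a y {n₁ k₁ c} → n₁ ≡ n + 1ℚ → k₁ ≡ k + 1ℚ → c ≡ 1ℚ + a - y →
      let e = n + (1ℚ + a) ; w = a + (k₁ + k₁) in
      β * (w * n₁ * e) * (y + n) + e * (β * ((n - k) * (c + k₁) * (a + k₁)))
      ≡ β * (w * (n - k) * (e + k₁)) * e + e * (β * (k₁ * (y + k) * (e + k₁)))
    identity β n k a y refl refl refl =
      solve 5 (λ β n k a y →
        let o = con 1ℚ ; c = o :+ a :- y ; e = n :+ (o :+ a) ; n₁ = n :+ o ; k₁ = k :+ o
            w = a :+ (k₁ :+ k₁) in
        β :* (w :* n₁ :* e) :* (y :+ n) :+ e :* (β :* ((n :- k) :* (c :+ k₁) :* (a :+ k₁)))
        := β :* (w :* (n :- k) :* (e :+ k₁)) :* e :+ e :* (β :* (k₁ :* (y :+ k) :* (e :+ k₁))))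
        refl β n k a y

  term-zero : ∀ m → term m 0 ≡ a
  term-zero m = solve 1 (λ a → con 1ℚ :* (a :+ con 0ℚ) :* con 1ℚ := a) refl a

  -- The boundary case, where the certificate at index -1 counts as 0. Since `certificate n 0` is c
  -- a / e, the claim reduces to a (y + n + c) = a e.
  telescope-zero : ∀ n → term (suc n) 0 * (y + ι n) + e n * certificate n 0 ≡ term n 0 * e n
  telescope-zero n = begin
    term (suc n) 0 * (y + ι n) + e n * certificate n 0
      ≡⟨ cong₂ (λ x z → x * (y + ι n) + e n * z) (term-zero (suc n)) certificate-zero ⟩
    a * (y + ι n) + e n * (c * a * r)
      ≡⟨ solve 6 (λ a c y n e r → a :* (y :+ n) :+ e :* (c :* a :* r)
           := a :* (y :+ n :+ c :* (e :* r))) refl a c y (ι n) (e n) r ⟩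
    a * (y + ι n + c * (e n * r))
      ≡⟨ cong (λ x → a * (y + ι n + c * x)) (*-inverseʳ (e n)) ⟩
    a * (y + ι n + c * 1ℚ)
      ≡⟨ solve 4 (λ a c y n → a :* (y :+ n :+ c :* con 1ℚ) := a :* (n :+ (c :+ y))) refl a c y (ι n) ⟩
    a * (ι n + (c + y)) ≡⟨ cong (λ x → a * (ι n + x)) c+y≡1+a ⟩
    a * e n             ≡⟨ cong (_* e n) (term-zero n) ⟨
    term n 0 * e n      ∎
    where
    instance
      e≢0 : NonZero (e n)
      e≢0 = >-nonZero (0<+ (0≤ι n) (0<+ (<⇒≤ (positive⁻¹ 1ℚ)) 0<a))

    r : ℚ
    r = 1/ e n

    certificate-zero : certificate n 0 ≡ c * a * r
    certificate-zero = trans (sym (*-identityˡ (certificate n 0)))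
      (trans (*÷-cross 1ℚ (numerator n 0) (denominator n 0 1 0) 1ℚ (e n) (c * a)
               {{denominator≢0 n 0 1 0}}
               (solve 3 (λ c a e → let o = con 1ℚ ; z = con 0ℚ in
                  o :* (o :* o :* (o :* (c :+ z)) :* (o :* (a :+ z))) :* e
                  := o :* (c :* a) :* (o :* (o :* (e :+ z)) :* o)) refl c a (e n)))
        (trans (cong (_* (c * a)) (*-identityˡ r)) (*-comm r (c * a))))

  -- Adding up `telescope` cancels all certificates but the last. The cut-off m is independent of n,
  -- so both sums run over the same range.
  ∑-telescope : ∀ n m →
    ∑[k< suc m ] (term (suc n)) * (y + ι n) + e n * certificate n m
    ≡ ∑[k< suc m ] (term n) * e n
  ∑-telescope n zero = begin
    (term (suc n) 0 + 0ℚ) * (y + ι n) + e n * certificate n 0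
      ≡⟨ cong (λ x → x * (y + ι n) + e n * certificate n 0) (+-identityʳ (term (suc n) 0)) ⟩
    term (suc n) 0 * (y + ι n) + e n * certificate n 0   ≡⟨ telescope-zero n ⟩
    term n 0 * e n                                       ≡⟨ cong (_* e n) (+-identityʳ (term n 0)) ⟨
    (term n 0 + 0ℚ) * e n                                ∎
  ∑-telescope n (suc m) = begin
    ∑[k< suc (suc m) ] (term (suc n)) * (y + ι n) + e n * certificate n (suc m)
      ≡⟨ cong (λ x → x * (y + ι n) + e n * certificate n (suc m)) (∑-last (suc m) (term (suc n))) ⟩
    (S′ + t′) * (y + ι n) + e n * certificate n (suc m)
      ≡⟨ solve 4 (λ s t z g → (s :+ t) :* z :+ g := s :* z :+ (t :* z :+ g)) refl
           S′ t′ (y + ι n) (e n * certificate n (suc m)) ⟩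
    S′ * (y + ι n) + (t′ * (y + ι n) + e n * certificate n (suc m))
      ≡⟨ cong (λ x → S′ * (y + ι n) + x) (telescope n m) ⟩
    S′ * (y + ι n) + (t * e n + e n * certificate n m)
      ≡⟨ solve 4 (λ x t z g → x :+ (t :* z :+ g) := x :+ g :+ t :* z) refl
           (S′ * (y + ι n)) t (e n) (e n * certificate n m) ⟩
    S′ * (y + ι n) + e n * certificate n m + t * e n
      ≡⟨ cong (λ x → x + t * e n) (∑-telescope n m) ⟩
    S * e n + t * e n
      ≡⟨ *-distribʳ-+ (e n) S t ⟨
    (S + t) * e n
      ≡⟨ cong (_* e n) (∑-last (suc m) (term n)) ⟨
    ∑[k< suc (suc m) ] (term n) * e n ∎
    where
    S′ S t′ t : ℚ
    S′ = ∑[k< suc m ] (term (suc n))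
    S  = ∑[k< suc m ] (term n)
    t′ = term (suc n) (suc m)
    t  = term n (suc m)

  term-vanishes : ∀ {n k} → n ℕ.<′ k → term n k ≡ 0ℚ
  term-vanishes {n} {k} n<k = step ((- 1ℚ) ^ k * weight k) (⦅ c ⦆ k) (⦅ a ⦆ k)
    (denominator n k k k) {{denominator≢0 n k k k}} (⦅-ι⦆-vanishes n<k)
    where
    step : ∀ s C B q .{{_ : NonZero q}} {A} → A ≡ 0ℚ → s * ((A * C * B) ÷ q) ≡ 0ℚ
    step s C B q refl =
      solve 4 (λ s C B i → s :* (con 0ℚ :* C :* B :* i) := con 0ℚ) refl s C B (1/ q)

  certificate-vanishes : ∀ {n k} → n ℕ.<′ k → certificate n k ≡ 0ℚ
  certificate-vanishes {n} {k} n<k = step ((- 1ℚ) ^ k) (⦅ c ⦆ (suc k)) (⦅ a ⦆ (suc k))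
    (denominator n k (suc k) k) {{denominator≢0 n k (suc k) k}} (⦅-ι⦆-vanishes n<k)
    where
    step : ∀ s C B q .{{_ : NonZero q}} {A} → A ≡ 0ℚ → (s * A * C * B) ÷ q ≡ 0ℚ
    step s C B q refl =
      solve 4 (λ s C B i → s :* con 0ℚ :* C :* B :* i := con 0ℚ) refl s C B (1/ q)

  -- Take m = n + 1 in `∑-telescope`: both `certificate n m` and `term n m` vanish, so the boundary
  -- disappears and the right-hand sum loses its last summand.
  ∑-suc : ∀ n → ∑[k< suc (suc n) ] (term (suc n)) * (y + ι n) ≡ ∑[k< suc n ] (term n) * e n
  ∑-suc n = begin
    S′ * (y + ι n)
      ≡⟨ solve 2 (λ s x → s := s :+ x :* con 0ℚ) refl (S′ * (y + ι n)) (e n) ⟩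
    S′ * (y + ι n) + e n * 0ℚ
      ≡⟨ cong (λ g → S′ * (y + ι n) + e n * g) (certificate-vanishes {n} ℕ.≤′-refl) ⟨
    S′ * (y + ι n) + e n * certificate n (suc n) ≡⟨ ∑-telescope n (suc n) ⟩
    ∑[k< suc (suc n) ] (term n) * e n            ≡⟨ cong (_* e n) (∑-last (suc n) (term n)) ⟩
    (S + term n (suc n)) * e n                   ≡⟨ cong (λ t → (S + t) * e n) (term-vanishes {n} ℕ.≤′-refl) ⟩
    (S + 0ℚ) * e n                               ≡⟨ cong (_* e n) (+-identityʳ S) ⟩
    S * e n                                      ∎
    where
    S′ S : ℚ
    S′ = ∑[k< suc (suc n) ] (term (suc n))
    S  = ∑[k< suc n ] (term n)

  -- Each use of `∑-suc` contributes y + n, the new factor of (y)ₙ₊₁, and `e n` = a + (n + 1), the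
  -- new factor of (a)ₙ₊₂.
  ∑-term : ∀ n → ∑[k< suc n ] (term n) * ⦅ y ⦆ n ≡ ⦅ a ⦆ (suc n)
  ∑-term zero = begin
    (term 0 0 + 0ℚ) * 1ℚ  ≡⟨ cong (λ t → (t + 0ℚ) * 1ℚ) (term-zero 0) ⟩
    (a + 0ℚ) * 1ℚ         ≡⟨ *-comm (a + 0ℚ) 1ℚ ⟩
    1ℚ * (a + 0ℚ)         ∎
  ∑-term (suc n) = begin
    S′ * (⦅ y ⦆ n * (y + ι n))
      ≡⟨ solve 3 (λ s p x → s :* (p :* x) := s :* x :* p) refl S′ (⦅ y ⦆ n) (y + ι n) ⟩
    S′ * (y + ι n) * ⦅ y ⦆ n   ≡⟨ cong (_* ⦅ y ⦆ n) (∑-suc n) ⟩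
    S * e n * ⦅ y ⦆ n
      ≡⟨ solve 3 (λ s p x → s :* x :* p := s :* p :* x) refl S (⦅ y ⦆ n) (e n) ⟩
    S * ⦅ y ⦆ n * e n          ≡⟨ cong₂ _*_ (∑-term n) e≡a+n+1 ⟩
    ⦅ a ⦆ (suc n) * (a + ι (suc n)) ∎
    where
    S′ S : ℚ
    S′ = ∑[k< suc (suc n) ] (term (suc n))
    S  = ∑[k< suc n ] (term n)

    e≡a+n+1 : e n ≡ a + ι (suc n)
    e≡a+n+1 = trans (solve 2 (λ n a → n :+ (con 1ℚ :+ a) := a :+ (n :+ con 1ℚ)) refl (ι n) a)
      (cong (λ x → a + x) (sym (ι-suc n)))

-- Specialisation to a = 1/2 and the closed product.

module Specialised (n : ℕ) where

  -- Both depend on the n of this module but stay constant in the induction of `WellPoised`, whose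
  -- own index is set to the same n only afterwards.
  c y : ℚ
  c = - (ι 3 * ι n) - 1ℚ
  y = ι 3 * ι n + + 5 / 2

  c+y≡3/2 : c + y ≡ 1ℚ + ½
  c+y≡3/2 = solve 1 (λ x → :- x :- con 1ℚ :+ (x :+ con (+ 5 / 2)) := con (+ 3 / 2)) refl (ι 3 * ι n)

  open WellPoised ½ c y (positive⁻¹ ½) (0<+ (0≤ι*ι 3 n) (positive⁻¹ (+ 5 / 2))) c+y≡3/2 public

  summand : ℕ → ℚ
  summand k =
    (- 1ℚ) ^ k * (ι 4 * ι k + 1ℚ)
    * ((⦅ - ι n ⦆ k * ⦅ c ⦆ k * ⦅ ½ ⦆ k) ÷ (ι (k !) * ⦅ ι n + + 3 / 2 ⦆ k * ⦅ y ⦆ k))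
      {{term-denominator≢0 n k}}

  -- 4k + 1 is twice the weight 1/2 + 2k. The quotients agree by computation, as `e n` unfolds to
  -- `ι n + + 3 / 2` and nonzeroness proofs are irrelevant.
  summand≡2*term : ∀ k → summand k ≡ ι 2 * term n k
  summand≡2*term k =
    solve 3 (λ σ k q → σ :* (con (ι 4) :* k :+ con 1ℚ) :* q
                     := con (ι 2) :* (σ :* (con ½ :+ (k :+ k)) :* q)) refl
      ((- 1ℚ) ^ k) (ι k)
      (((⦅ - ι n ⦆ k * ⦅ c ⦆ k * ⦅ ½ ⦆ k) ÷ (ι (k !) * ⦅ ι n + + 3 / 2 ⦆ k * ⦅ y ⦆ k))
        {{term-denominator≢0 n k}})

  summand-vanishes : ∀ k → suc n ℕ.≤ k → summand k ≡ 0ℚ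
  summand-vanishes k n<k = begin
    summand k       ≡⟨ summand≡2*term k ⟩
    ι 2 * term n k  ≡⟨ cong (ι 2 *_) (term-vanishes (ℕ.≤⇒≤′ n<k)) ⟩
    0ℚ              ∎

  ∑-summand : ∑[k< suc n ] summand * ⦅ y ⦆ n ≡ ⦅ + 3 / 2 ⦆ n
  ∑-summand = begin
    ∑[k< suc n ] summand * ⦅ y ⦆ n
      ≡⟨ cong (_* ⦅ y ⦆ n) (Sum.sum-cong-≗ semiring {suc n} (λ i → summand≡2*term (toℕ i))) ⟩
    ∑[k< suc n ] (λ k → ι 2 * term n k) * ⦅ y ⦆ n
      ≡⟨ cong (_* ⦅ y ⦆ n) (Sum.*-distribˡ-sum semiring {suc n} (ι 2) (λ i → term n (toℕ i))) ⟨
    ι 2 * ∑[k< suc n ] (term n) * ⦅ y ⦆ n   ≡⟨ *-assoc (ι 2) (∑[k< suc n ] (term n)) (⦅ y ⦆ n) ⟩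
    ι 2 * (∑[k< suc n ] (term n) * ⦅ y ⦆ n) ≡⟨ cong (ι 2 *_) (∑-term n) ⟩
    -- The first factor 1/2 of (1/2)ₙ₊₁ cancels the 2.
    ι 2 * ⦅ ½ ⦆ (suc n)                     ≡⟨ cong (ι 2 *_) (⦅⦆-shift ½ n) ⟩
    ι 2 * (½ * ⦅ + 3 / 2 ⦆ n)               ≡⟨ *-assoc (ι 2) ½ (⦅ + 3 / 2 ⦆ n) ⟨
    1ℚ * ⦅ + 3 / 2 ⦆ n                      ≡⟨ *-identityˡ (⦅ + 3 / 2 ⦆ n) ⟩
    ⦅ + 3 / 2 ⦆ n                           ∎

  -- Both sides equal (1/256)ⁿ (5/2)₄ₙ, split as (5/2)₃ₙ (3n + 5/2)ₙ on the right.
  multiplication :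
    ⦅ + 5 / 8 ⦆ n * ⦅ + 7 / 8 ⦆ n * ⦅ + 9 / 8 ⦆ n * ⦅ + 11 / 8 ⦆ n
    ≡ (+ 27 / 256) ^ n * (⦅ + 5 / 6 ⦆ n * ⦅ + 7 / 6 ⦆ n * ⦅ + 3 / 2 ⦆ n) * ⦅ y ⦆ n
  multiplication = begin
    ⦅ + 5 / 8 ⦆ n * ⦅ + 7 / 8 ⦆ n * ⦅ + 9 / 8 ⦆ n * ⦅ + 11 / 8 ⦆ n
      -- By computation 4 (5/8) = 5/2 = 3 (5/6), and the shifts 5/8 + i/4 and 5/6 + i/3 are the
      -- listed parameters.
      ≡⟨ ⦅⦆-quadruplication (+ 5 / 8) n ⟨
    u * ⦅ + 5 / 2 ⦆ (n ℕ.* 4)             ≡⟨ cong (λ m → u * ⦅ + 5 / 2 ⦆ m) (ℕ.*-suc n 3) ⟩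
    u * ⦅ + 5 / 2 ⦆ (n ℕ.+ n ℕ.* 3)       ≡⟨ cong (u *_) (⦅⦆-+ (+ 5 / 2) (n ℕ.* 3) n) ⟩
    u * (⦅ + 5 / 2 ⦆ (n ℕ.* 3) * ⦅ + 5 / 2 + ι (n ℕ.* 3) ⦆ n)
      ≡⟨ cong₂ (λ p x → u * (p * ⦅ x ⦆ n)) (⦅⦆-triplication (+ 5 / 6) n) 5/2+3n≡y ⟩
    u * (ι 27 ^ n * p * ⦅ y ⦆ n)
      ≡⟨ solve 4 (λ u v p q → u :* (v :* p :* q) := v :* u :* p :* q) refl u (ι 27 ^ n) p (⦅ y ⦆ n) ⟩
    ι 27 ^ n * u * p * ⦅ y ⦆ n
      ≡⟨ cong (λ r → r * p * ⦅ y ⦆ n) (^-distrib-* commutativeSemiring (ι 27) (+ 1 / 256) n) ⟨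
    (+ 27 / 256) ^ n * p * ⦅ y ⦆ n ∎
    where
    u p : ℚ
    u = (+ 1 / 256) ^ n
    p = ⦅ + 5 / 6 ⦆ n * ⦅ + 7 / 6 ⦆ n * ⦅ + 3 / 2 ⦆ n

    5/2+3n≡y : + 5 / 2 + ι (n ℕ.* 3) ≡ y
    5/2+3n≡y = trans (cong (λ x → + 5 / 2 + x) (ι-* n 3))
      (solve 1 (λ n → con (+ 5 / 2) :+ n :* con (ι 3) := con (ι 3) :* n :+ con (+ 5 / 2)) refl (ι n))

theorem4 : ∀ (n : ℕ) →
    HasSum
    (λ k →
    (- 1ℚ) ^ k * (ι 4 * ι k + 1ℚ)
    * ((⦅ - ι n ⦆ k * ⦅ - (ι 3 * ι n) - 1ℚ ⦆ k * ⦅ ½ ⦆ k)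
    ÷ (ι (k !) * ⦅ ι n + + 3 / 2 ⦆ k * ⦅ ι 3 * ι n + + 5 / 2 ⦆ k))
    {{term-denominator≢0 n k}})
    ((+ (3 ℕ.^ 3) / (2 ℕ.^ 8)) ^ n
    * ((⦅ + 7 / 6 ⦆ n * ⦅ + 5 / 6 ⦆ n * (⦅ + 3 / 2 ⦆ n) ^ 2)
    ÷ (⦅ + 5 / 8 ⦆ n * ⦅ + 7 / 8 ⦆ n * ⦅ + 9 / 8 ⦆ n * ⦅ + 11 / 8 ⦆ n))
    {{value-denominator≢0 n}})
-- The terms vanish from index n + 1 on, hence the cut-off. `*÷-cross` with right-hand quotient 1/1
-- and r = S clears the denominator of the value.
theorem4 n = suc n , summand-vanishes , sym (trans
  (*÷-cross ((+ 27 / 256) ^ n) (⦅ + 7 / 6 ⦆ n * ⦅ + 5 / 6 ⦆ n * h ^ 2)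
    (⦅ + 5 / 8 ⦆ n * ⦅ + 7 / 8 ⦆ n * ⦅ + 9 / 8 ⦆ n * ⦅ + 11 / 8 ⦆ n) 1ℚ 1ℚ S
    {{value-denominator≢0 n}}
    (cross (⦅ + 7 / 6 ⦆ n) (⦅ + 5 / 6 ⦆ n) ((+ 27 / 256) ^ n) (⦅ y ⦆ n) S ∑-summand multiplication))
  (*-identityˡ S))
  where
  open Specialised n

  S h : ℚ
  S = ∑[k< suc n ] summand
  h = ⦅ + 3 / 2 ⦆ n

  -- The value contains h = (3/2)ₙ twice: one h is matched by `multiplication`, the other is S (y)ₙ
  -- by `∑-summand`.
  cross : ∀ p q r z s {h d} → s * z ≡ h → d ≡ r * (q * p * h) * z →
    r * (p * q * h ^ 2) * 1ℚ ≡ 1ℚ * s * d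
  cross p q r z s refl refl = solve 5 (λ p q r z s →
    r :* (p :* q :* (s :* z :* (s :* z :* con 1ℚ))) :* con 1ℚ
    := con 1ℚ :* s :* (r :* (q :* p :* (s :* z)) :* z)) refl p q r z s
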